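{- Let $G$ and $H$ be two finite groups, written additively, and let $F\colon G\to H$ be a perfect nonlinear function. If $|H|\le\sqrt{|G|}$, then $F$ is surjective. Moreover, under this hypothesis, a preimage set of size $1$ (i.e. $|F^{ -1}(\beta)|=1$ for some $\beta\in H$) is only possible if $|H|=\sqrt{|G|}$.
   Context: A function $F\colon G\to H$ between finite groups is perfect nonlinear if $|\{x\in G: F(x+a)-F(x)=b\}|=|G|/|H|$ for all $a\in G\setminus\{0\}$ and all $b\in H$. $F^{ -1}(\beta)$ denotes the preimage set of $\beta$. -}

module Defs where

open import Algebra.Bundles using (Group)
open import Data.Fin.Base using (Fin)
import Data.Fin.Properties as Fin
open import Data.Integer.Base using (+_)
open import Data.Nat.Base using (ℕ; NonZero)
open import Data.Rational.Unnormalised.Base using (_≃_; _/_)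
open import Data.Vec.Base using (Vec; tabulate; count)
open import Function.Bundles using (Func; Inverse)
open import Function.Definitions using () renaming (Surjective to FSurjective)
open import Function.Properties.Inverse using (Inverse⇒Injection)
open import Level using (Level; suc; _⊔_)
open import Relation.Binary.Definitions using (Decidable)
open import Relation.Binary.PropositionalEquality using (setoid)
open import Relation.Nullary.Decidable using (via-injection)
open import Relation.Nullary.Negation using (¬_)
open import Relation.Unary using (Pred) renaming (Decidable to Decidable₁)

private
  variable
    c₁ ℓ₁ c₂ ℓ₂ : Level

-- The group is not assumed commutative; it is merely written additively.
record FiniteGroup (c ℓ : Level) : Set (suc (c ⊔ ℓ)) where
  field
    group       : Group c ℓ
    order       : ℕ
    enumeration : Inverse (Group.setoid group) (setoid (Fin order))

  open Group group public hiding (_-_)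
    renaming (_∙_ to infixl 6 _+_; ε to 0#; _⁻¹ to -_; _//_ to _-_)

  open Inverse enumeration using (to; from)

  infix 4 _≟_

  _≟_ : Decidable _≈_
  _≟_ = via-injection (Inverse⇒Injection enumeration) Fin._≟_

  -- One representative of each ≈-class.
  elements : Vec Carrier order
  elements = tabulate from

  -- The number of elements satisfying a predicate. This is only the size of a
  -- subset of the group when the predicate respects _≈_.
  card : ∀ {p} {P : Pred Carrier p} → Decidable₁ P → ℕ
  card P? = count P? elements

  instance
    order-nonZero : NonZero order
    order-nonZero = Fin.nonZeroIndex (to 0#)

open FiniteGroup using (order)

∣_∣ : FiniteGroup c₁ ℓ₁ → ℕ
∣ G ∣ = order G

module _ (G : FiniteGroup c₁ ℓ₁) (H : FiniteGroup c₂ ℓ₂) where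
  private
    module G = FiniteGroup G
    module H = FiniteGroup H

  -- Arbitrary functions G → H (not homomorphisms).
  Map : Set (c₁ ⊔ ℓ₁ ⊔ c₂ ⊔ ℓ₂)
  Map = Func G.setoid H.setoid

  module _ (F : Map) where
    open Func F using () renaming (to to f)

    ∣preimage∣ : H.Carrier → ℕ
    ∣preimage∣ β = G.card (λ x → f x H.≟ β)

    ∣derivativeFibre∣ : G.Carrier → H.Carrier → ℕ
    ∣derivativeFibre∣ a b = G.card (λ x → (f (x G.+ a) H.- f x) H.≟ b)

    -- |G|/|H| is a rational quotient: divisibility is not presupposed.
    PerfectNonlinear : Set (c₁ ⊔ ℓ₁ ⊔ c₂)
    PerfectNonlinear = ∀ a → ¬ (a G.≈ G.0#) → ∀ b →
      + ∣derivativeFibre∣ a b / 1 ≃ + ∣ G ∣ / ∣ H ∣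

    Surjective : Set (c₁ ⊔ ℓ₁ ⊔ c₂ ⊔ ℓ₂)
    Surjective = FSurjective G._≈_ H._≈_ f

{-# OPTIONS --safe #-}

-- Let m = |H|, n = |G| and k β = |F⁻¹(β)|. Counting the pairs with equal image by
-- their difference, and using nonlinearity only for b = 0, gives
-- m Σ (k β)² = n (n - 1) + m n, while Σ k β = n. Cauchy–Schwarz over the m - 1
-- fibres other than a given one then bounds n: by (m - 1)² if that fibre is empty,
-- and by m² if it is a singleton.
module Submission where

open import Defs
import Algebra.Properties.Group as GroupProperties
open import Data.Bool.Base using (if_then_else_; true; false)
open import Data.Fin.Base using (Fin; zero; suc)
open import Data.Fin.Permutation using (Permutation′; permutation)
open import Data.Fin.Properties using (any?) renaming (_≟_ to _≟ᶠ_)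
import Data.Integer.Base as ℤ
import Data.Integer.Properties as ℤ
open import Data.Nat.Base
open import Data.Nat.Properties
open import Data.Nat.Tactic.RingSolver using (solve-∀)
open import Data.Product.Base using (∃-syntax; _×_; _,_)
open import Data.Rational.Unnormalised.Base using (_≃_; *≡*) renaming (_/_ to _/ᵘ_)
open import Data.Vec.Base using (tabulate; count)
open import Data.Vec.Functional using (Vector; replicate; removeAt)
open import Function.Base using (_∘_)
open import Function.Bundles using (_⇔_; mk⇔; module Func; module Inverse)
open import Level using (Level)
open import Relation.Binary.PropositionalEquality
open import Relation.Nullary.Decidable using (Dec; does; yes; no; does-⇔; dec-true; dec-false)
open import Relation.Nullary.Negation using (¬_; contradiction)
open import Relation.Unary using (Pred; Decidable)

open import Algebra.Properties.Semiring.Sum +-*-semiring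

private
  variable
    a p : Level
    A : Set a
    m n : ℕ

-- Cauchy-Schwarz over the natural numbers

2*[m*n]≤m*m+n*n : ∀ m n → 2 * (m * n) ≤ m * m + n * n
2*[m*n]≤m*m+n*n zero n = z≤n
2*[m*n]≤m*m+n*n (suc m) zero rewrite *-zeroʳ m = z≤n
2*[m*n]≤m*m+n*n (suc m) (suc n) = begin
  2 * (suc m * suc n)                     ≡⟨ lhs m n ⟩
  -- Raising both arguments by one adds the same `2 * (m + n + 1)` to either side, so the induction
  -- never has to subtract.
  2 * (m * n) + 2 * (m + n + 1)           ≤⟨ +-monoˡ-≤ _ (2*[m*n]≤m*m+n*n m n) ⟩
  m * m + n * n + 2 * (m + n + 1)         ≡⟨ rhs m n ⟩
  suc m * suc m + suc n * suc n           ∎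
  where
  open ≤-Reasoning
  lhs : ∀ m n → 2 * (suc m * suc n) ≡ 2 * (m * n) + 2 * (m + n + 1)
  lhs = solve-∀
  rhs : ∀ m n → m * m + n * n + 2 * (m + n + 1) ≡ suc m * suc m + suc n * suc n
  rhs = solve-∀

sum-replicate-* : ∀ n x → sum (replicate n x) ≡ n * x
sum-replicate-* zero    x = refl
sum-replicate-* (suc n) x = cong (x +_) (sum-replicate-* n x)

2*m*sum≤ : ∀ {n} m (v : Vector ℕ n) →
           2 * (m * sum v) ≤ n * (m * m) + sum (λ i → v i * v i)
2*m*sum≤ {zero}  m v rewrite *-zeroʳ m = z≤n
2*m*sum≤ {suc n} m v = begin
  2 * (m * (x + s))                    ≡⟨ split m x s ⟩
  2 * (m * x) + 2 * (m * s)            ≤⟨ +-mono-≤ (2*[m*n]≤m*m+n*n m x) (2*m*sum≤ m (v ∘ suc)) ⟩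
  m * m + x * x + (n * (m * m) + q)    ≡⟨ regroup (m * m) (x * x) (n * (m * m)) q ⟩
  m * m + n * (m * m) + (x * x + q)    ∎
  where
  open ≤-Reasoning
  x = v zero
  s = sum (v ∘ suc)
  q = sum (λ i → v (suc i) * v (suc i))
  split : ∀ m x s → 2 * (m * (x + s)) ≡ 2 * (m * x) + 2 * (m * s)
  split = solve-∀
  regroup : ∀ a b c d → a + b + (c + d) ≡ a + c + (b + d)
  regroup = solve-∀

-- Induction on the length: splitting off the head `x`, the cross term `2 * (x * s)` is exactly what
-- `2*m*sum≤` bounds.
cauchy-schwarz : ∀ {n} (v : Vector ℕ n) → sum v * sum v ≤ n * sum (λ i → v i * v i)
cauchy-schwarz {zero}  v = z≤n
cauchy-schwarz {suc n} v = begin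
  (x + s) * (x + s)                          ≡⟨ expand x s ⟩
  x * x + 2 * (x * s) + s * s                ≤⟨ +-mono-≤ (+-monoʳ-≤ (x * x) (2*m*sum≤ x (v ∘ suc))) (cauchy-schwarz (v ∘ suc)) ⟩
  x * x + (n * (x * x) + q) + n * q          ≡⟨ collect n x q ⟩
  suc n * (x * x + q)                        ∎
  where
  open ≤-Reasoning
  x = v zero
  s = sum (v ∘ suc)
  q = sum (λ i → v (suc i) * v (suc i))
  expand : ∀ x s → (x + s) * (x + s) ≡ x * x + 2 * (x * s) + s * s
  expand = solve-∀
  collect : ∀ n x q → x * x + (n * (x * x) + q) + n * q ≡ suc n * (x * x + q)
  collect = solve-∀

-- Indicator sums and fibre sizes

𝟙 : Dec A → ℕ
𝟙 a? = if does a? then 1 else 0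

𝟙-cong : ∀ {b} {B : Set b} → A ⇔ B → (a? : Dec A) (b? : Dec B) → 𝟙 a? ≡ 𝟙 b?
𝟙-cong A⇔B a? b? = cong (if_then 1 else 0) (does-⇔ A⇔B a? b?)

count-tabulate : {P : Pred A p} (P? : Decidable P) (f : Fin n → A) →
                 count P? (tabulate f) ≡ sum (λ i → 𝟙 (P? (f i)))
count-tabulate {n = zero}  P? f = refl
count-tabulate {n = suc n} P? f with does (P? (f zero))
... | true  = cong suc (count-tabulate P? (f ∘ suc))
... | false = count-tabulate P? (f ∘ suc)

sum-𝟙≟-* : (i : Fin n) (h : Vector ℕ n) → sum (λ j → 𝟙 (i ≟ᶠ j) * h j) ≡ h i
sum-𝟙≟-* {suc n} zero h =
  trans (cong₂ _+_ (*-identityˡ (h zero)) (sum-replicate-zero n)) (+-identityʳ (h zero))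
-- The head term computes to `0`, and comparing successors computes to comparing predecessors.
sum-𝟙≟-* (suc i) h = sum-𝟙≟-* i (h ∘ suc)

module _ (g : Fin n → Fin m) where
  fibre : Vector ℕ m
  fibre j = sum (λ i → 𝟙 (g i ≟ᶠ j))

  -- Double counting: each `i` contributes `h` at its own value `g i`. A constant `h` recovers the
  -- total size, and `h = fibre` counts the pairs with equal image.
  sum-fibre-* : (h : Vector ℕ m) → sum (λ j → fibre j * h j) ≡ sum (h ∘ g)
  sum-fibre-* h = begin
    sum (λ j → fibre j * h j)                        ≡⟨ sum-cong-≗ (λ j → *-distribʳ-sum (h j) (λ i → 𝟙 (g i ≟ᶠ j))) ⟩
    sum (λ j → sum (λ i → 𝟙 (g i ≟ᶠ j) * h j))       ≡⟨ ∑-comm (λ j i → 𝟙 (g i ≟ᶠ j) * h j) ⟩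
    sum (λ i → sum (λ j → 𝟙 (g i ≟ᶠ j) * h j))       ≡⟨ sum-cong-≗ (λ i → sum-𝟙≟-* (g i) h) ⟩
    sum (h ∘ g)                                      ∎
    where open ≡-Reasoning

  sum-fibre : sum fibre ≡ n
  sum-fibre = begin
    sum fibre                  ≡⟨ sum-cong-≗ (λ j → *-identityʳ (fibre j)) ⟨
    sum (λ j → fibre j * 1)    ≡⟨ sum-fibre-* (λ _ → 1) ⟩
    sum (replicate n 1)        ≡⟨ sum-replicate-* n 1 ⟩
    n * 1                      ≡⟨ *-identityʳ n ⟩
    n                          ∎
    where open ≡-Reasoning

  fibre≢0⇒∃ : ∀ j → fibre j ≢ 0 → ∃[ i ] g i ≡ j
  fibre≢0⇒∃ j fibre≢0 with any? (λ i → g i ≟ᶠ j)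
  ... | yes i,gi≡j = i,gi≡j
  ... | no  ¬∃     = contradiction fibre≡0 fibre≢0
    where
    fibre≡0 : fibre j ≡ 0
    fibre≡0 = trans
      (sum-cong-≗ (λ i → cong (if_then 1 else 0) (dec-false (g i ≟ᶠ j) (λ e → ¬∃ (i , e)))))
      (sum-replicate-zero n)

-- Bounds from the second moment

cauchy-schwarz-removeAt : (v : Vector ℕ (suc m)) (i : Fin (suc m)) →
  ∃[ s ] ∃[ q ] v i + s ≡ sum v × v i * v i + q ≡ sum (λ j → v j * v j) × s * s ≤ m * q
cauchy-schwarz-removeAt v i =
  -- Only `m` entries remain after the removal; this factor `m` instead of `suc m` is what makes the
  -- bounds below effective.
  _ , _ , sym (sum-remove v) , sym (sum-remove (λ j → v j * v j)) , cauchy-schwarz (removeAt v i)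

-- The second-moment identity m Σ (v j)² = n (n - 1) + m n, moved so that no
-- subtraction occurs.
SecondMoment : ℕ → Vector ℕ m → Set
SecondMoment {m} n v = m * sum (λ j → v j * v j) + n ≡ n * n + m * n

-- The other fibres carry the full sum `n`, so `n * n ≤ m * q`. Multiplying by `suc m` and inserting
-- the moment identity leaves `n * n ≤ m * m * n`, and one factor `n` cancels.
empty-fibre-bound : ∀ .{{_ : NonZero n}} (v : Vector ℕ (suc m)) i → sum v ≡ n → SecondMoment n v →
                    v i ≡ 0 → n ≤ m * m
empty-fibre-bound {n} {m} v i Σv≡n moment vi≡0
  with s , q , s-eq , q-eq , s²≤mq ← cauchy-schwarz-removeAt v i
  rewrite vi≡0 | trans s-eq Σv≡n | sym q-eq
  = *-cancelʳ-≤ n (m * m) n (+-cancelˡ-≤ (m * (n * n) + m * n) _ _ (begin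
      m * (n * n) + m * n + n * n          ≡⟨ lhs m n ⟩
      suc m * (n * n) + m * n              ≤⟨ +-monoˡ-≤ (m * n) (*-monoʳ-≤ (suc m) s²≤mq) ⟩
      suc m * (m * q) + m * n              ≡⟨ factor m n q ⟩
      m * (suc m * q + n)                  ≡⟨ cong (m *_) moment ⟩
      m * (n * n + suc m * n)              ≡⟨ rhs m n ⟩
      m * (n * n) + m * n + m * m * n      ∎))
  where
  open ≤-Reasoning
  lhs : ∀ m n → m * (n * n) + m * n + n * n ≡ suc m * (n * n) + m * n
  lhs = solve-∀
  factor : ∀ m n q → suc m * (m * q) + m * n ≡ m * (suc m * q + n)
  factor = solve-∀
  rhs : ∀ m n → m * (n * n + suc m * n) ≡ m * (n * n) + m * n + m * m * n
  rhs = solve-∀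

-- The other fibres have sum `t` with `n = suc t`. Eliminating `q` as before gives
-- `t * t ≤ (m * m + 2 * m) * t`, and `m * m + 2 * m` is one less than the square of `suc m`.
singleton-fibre-bound : (v : Vector ℕ (suc m)) → ∀ i → sum v ≡ n → SecondMoment n v →
                        v i ≡ 1 → n ≤ suc m * suc m
singleton-fibre-bound {m} v i refl moment vi≡1
  with s , q , s-eq , q-eq , s²≤mq ← cauchy-schwarz-removeAt v i
  rewrite vi≡1 | sym s-eq | sym q-eq
  with s
-- Here `n = 1`; the case is separate because the main argument cancels a factor `t`.
... | zero  = s≤s z≤n
... | t@(suc _) = begin
    suc t                    ≤⟨ s≤s (*-cancelʳ-≤ t (m * m + 2 * m) t (+-cancelˡ-≤ (m * (t * t)) _ _ t²-bound)) ⟩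
    suc (m * m + 2 * m)      ≡⟨ square m ⟩
    suc m * suc m            ∎
  where
  open ≤-Reasoning
  square : ∀ m → suc (m * m + 2 * m) ≡ suc m * suc m
  square = solve-∀
  lhs : ∀ m t → m * (t * t) + t * t ≡ suc m * (t * t)
  lhs = solve-∀
  swap : ∀ m q → suc m * (m * q) ≡ m * (suc m * q)
  swap = solve-∀
  rhs : ∀ m t → m * (t * t + 2 * t + m * t) ≡ m * (t * t) + (m * m + 2 * m) * t
  rhs = solve-∀
  momentˡ : ∀ m t q → suc m * q + (suc m + suc t) ≡ suc m * suc q + suc t
  momentˡ = solve-∀
  momentʳ : ∀ m t → suc t * suc t + suc m * suc t ≡ t * t + 2 * t + m * t + (suc m + suc t)
  momentʳ = solve-∀
  reduced : suc m * q ≡ t * t + 2 * t + m * t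
  reduced = +-cancelʳ-≡ (suc m + suc t) _ _ (trans (momentˡ m t q) (trans moment (momentʳ m t)))
  t²-bound : m * (t * t) + t * t ≤ m * (t * t) + (m * m + 2 * m) * t
  t²-bound = begin
    m * (t * t) + t * t                    ≡⟨ lhs m t ⟩
    suc m * (t * t)                        ≤⟨ *-monoʳ-≤ (suc m) s²≤mq ⟩
    suc m * (m * q)                        ≡⟨ swap m q ⟩
    m * (suc m * q)                        ≡⟨ cong (m *_) reduced ⟩
    m * (t * t + 2 * t + m * t)            ≡⟨ rhs m t ⟩
    m * (t * t) + (m * m + 2 * m) * t      ∎

-- The second moment of a perfect nonlinear function

/1≃/⇒*≡ : ∀ k n m .{{_ : NonZero m}} → (ℤ.+ k) /ᵘ 1 ≃ (ℤ.+ n) /ᵘ m → m * k ≡ n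
/1≃/⇒*≡ k n m@(suc _) (*≡* eq) = ℤ.+-injective (begin
  ℤ.+ (m * k)          ≡⟨ cong ℤ.+_ (*-comm m k) ⟩
  ℤ.+ (k * m)          ≡⟨ ℤ.pos-* k m ⟩
  ℤ.+ k ℤ.* ℤ.+ m      ≡⟨ eq ⟩
  ℤ.+ n ℤ.* ℤ.+ 1      ≡⟨ ℤ.*-identityʳ (ℤ.+ n) ⟩
  ℤ.+ n                ∎)
  where open ≡-Reasoning

module _ {c₁ ℓ₁} (G : FiniteGroup c₁ ℓ₁) where
  private module G = FiniteGroup G
  open Inverse G.enumeration

  leftTranslation : Fin G.order → Permutation′ G.order
  leftTranslation i = permutation
    (λ j → to (from i G.+ from j))
    (λ j → to (from i G.\\ from j))
    (λ j → inverseˡ (G.trans (G.∙-congˡ (strictlyInverseʳ _)) (\\-leftDividesˡ (from i) (from j))))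
    (λ j → inverseˡ (G.trans (G.∙-congˡ (strictlyInverseʳ _)) (\\-leftDividesʳ (from i) (from j))))
    where open GroupProperties G.group

module _ {c₁ ℓ₁ c₂ ℓ₂} (G : FiniteGroup c₁ ℓ₁) (H : FiniteGroup c₂ ℓ₂) (F : Map G H) where
  private
    module G = FiniteGroup G
    module H = FiniteGroup H
    module F = Func F
    module eG = Inverse G.enumeration
    module eH = Inverse H.enumeration

  onIndices : Fin G.order → Fin H.order
  onIndices i = eH.to (F.to (eG.from i))

  ∣preimage∣≡fibre : ∀ β → ∣preimage∣ G H F β ≡ fibre onIndices (eH.to β)
  ∣preimage∣≡fibre β = count-tabulate (λ x → F.to x H.≟ β) eG.from

  coincidences : Fin G.order → ℕ
  coincidences a = sum (λ i → 𝟙 (onIndices (eG.to (eG.from i G.+ eG.from a)) ≟ᶠ onIndices i))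

  ∣derivativeFibre∣≡coincidences : ∀ a → ∣derivativeFibre∣ G H F (eG.from a) H.0# ≡ coincidences a
  ∣derivativeFibre∣≡coincidences a = trans
    (count-tabulate (λ x → (F.to (x G.+ eG.from a) H.- F.to x) H.≟ H.0#) eG.from)
    (sum-cong-≗ λ i → let x+a = eG.from i G.+ eG.from a in 𝟙-cong
      (mk⇔
        -- `onIndices` sees the representative of `x+a`, so `F.cong` is needed to pass between the
        -- two.
        (λ e → eH.to-cong (H.trans (F.cong (eG.strictlyInverseʳ x+a)) (x∙y⁻¹≈ε⇒x≈y _ _ e)))
        (λ e → x≈y⇒x∙y⁻¹≈ε (H.trans (F.cong (G.sym (eG.strictlyInverseʳ x+a))) (toH-injective e))))
      (_ H.≟ _) (_ ≟ᶠ _))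
    where
    open GroupProperties H.group
    toH-injective : ∀ {x y} → eH.to x ≡ eH.to y → x H.≈ y
    toH-injective {x} {y} e =
      H.trans (H.sym (eH.strictlyInverseʳ x)) (eH.inverseʳ e)

  -- Both sides count the ordered pairs with equal image, on the right grouped by their difference
  -- `a`.
  sum-fibre² : sum (λ j → fibre onIndices j * fibre onIndices j) ≡ sum coincidences
  sum-fibre² = begin
    sum (λ j → fibre onIndices j * fibre onIndices j)
      ≡⟨ sum-fibre-* onIndices (fibre onIndices) ⟩
    sum (λ i → sum (λ i′ → 𝟙 (onIndices i′ ≟ᶠ onIndices i)))
      ≡⟨ sum-cong-≗ (λ i → sum-permute (λ i′ → 𝟙 (onIndices i′ ≟ᶠ onIndices i)) (leftTranslation G i)) ⟩
    sum (λ i → sum (λ a → 𝟙 (onIndices (eG.to (eG.from i G.+ eG.from a)) ≟ᶠ onIndices i)))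
      ≡⟨ ∑-comm (λ i a → 𝟙 (onIndices (eG.to (eG.from i G.+ eG.from a)) ≟ᶠ onIndices i)) ⟩
    sum coincidences ∎
    where open ≡-Reasoning

  coincidences-0 : coincidences (eG.to G.0#) ≡ G.order
  coincidences-0 = begin
    coincidences (eG.to G.0#)    ≡⟨ sum-cong-≗ (λ i → cong (if_then 1 else 0) (dec-true (_ ≟ᶠ _) (fixed i))) ⟩
    sum (replicate G.order 1)    ≡⟨ sum-replicate-* G.order 1 ⟩
    G.order * 1                  ≡⟨ *-identityʳ G.order ⟩
    G.order                      ∎
    where
    open ≡-Reasoning
    fixed : ∀ i → onIndices (eG.to (eG.from i G.+ eG.from (eG.to G.0#))) ≡ onIndices i
    fixed i = cong onIndices (eG.inverseˡ
      (G.trans (G.∙-congˡ (eG.strictlyInverseʳ G.0#)) (G.identityʳ _)))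

  module _ (pn : PerfectNonlinear G H F) where
    private
      0ᶠ = eG.to G.0#

    -- The indicator terms make one formula cover a = 0 as well as a ≠ 0.
    coincidences-uniform : ∀ a →
      ∣ H ∣ * coincidences a + 𝟙 (0ᶠ ≟ᶠ a) * ∣ G ∣ ≡ ∣ G ∣ + 𝟙 (0ᶠ ≟ᶠ a) * (∣ H ∣ * ∣ G ∣)
    coincidences-uniform a with 0ᶠ ≟ᶠ a
    ... | yes refl = begin
      ∣ H ∣ * coincidences 0ᶠ + 1 * ∣ G ∣    ≡⟨ cong (λ c → ∣ H ∣ * c + 1 * ∣ G ∣) coincidences-0 ⟩
      ∣ H ∣ * ∣ G ∣ + 1 * ∣ G ∣              ≡⟨ rearrange ∣ H ∣ ∣ G ∣ ⟩
      ∣ G ∣ + 1 * (∣ H ∣ * ∣ G ∣)            ∎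
      where
      open ≡-Reasoning
      rearrange : ∀ m n → m * n + 1 * n ≡ n + 1 * (m * n)
      rearrange = solve-∀
    ... | no 0≢a = cong (_+ 0) (trans
      (cong (∣ H ∣ *_) (sym (∣derivativeFibre∣≡coincidences a)))
      (/1≃/⇒*≡ _ ∣ G ∣ ∣ H ∣ (pn (eG.from a) a≉0 H.0#)))
      where
      a≉0 : ¬ (eG.from a G.≈ G.0#)
      a≉0 a≈0 = 0≢a (trans (eG.to-cong (G.sym a≈0)) (eG.strictlyInverseˡ a))

    -- Sum of `coincidences-uniform` over all `a`; each indicator term survives only at `a = 0`.
    secondMoment : SecondMoment ∣ G ∣ (fibre onIndices)
    secondMoment = begin
      ∣ H ∣ * sum (λ j → fibre onIndices j * fibre onIndices j) + ∣ G ∣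
        -- The lone `∣ G ∣` becomes an indicator sum, so that it merges termwise with the sum over
        -- `a`.
        ≡⟨ cong₂ _+_ (cong (∣ H ∣ *_) sum-fibre²) (sym (sum-𝟙≟-* 0ᶠ (λ _ → ∣ G ∣))) ⟩
      ∣ H ∣ * sum coincidences + sum (λ a → 𝟙 (0ᶠ ≟ᶠ a) * ∣ G ∣)
        ≡⟨ cong (_+ sum (λ a → 𝟙 (0ᶠ ≟ᶠ a) * ∣ G ∣)) (*-distribˡ-sum ∣ H ∣ coincidences) ⟩
      sum (λ a → ∣ H ∣ * coincidences a) + sum (λ a → 𝟙 (0ᶠ ≟ᶠ a) * ∣ G ∣)
        ≡⟨ ∑-distrib-+ (λ a → ∣ H ∣ * coincidences a) (λ a → 𝟙 (0ᶠ ≟ᶠ a) * ∣ G ∣) ⟨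
      sum (λ a → ∣ H ∣ * coincidences a + 𝟙 (0ᶠ ≟ᶠ a) * ∣ G ∣)
        ≡⟨ sum-cong-≗ coincidences-uniform ⟩
      sum (λ a → ∣ G ∣ + 𝟙 (0ᶠ ≟ᶠ a) * (∣ H ∣ * ∣ G ∣))
        ≡⟨ ∑-distrib-+ (λ _ → ∣ G ∣) (λ a → 𝟙 (0ᶠ ≟ᶠ a) * (∣ H ∣ * ∣ G ∣)) ⟩
      sum (replicate ∣ G ∣ ∣ G ∣) + sum (λ a → 𝟙 (0ᶠ ≟ᶠ a) * (∣ H ∣ * ∣ G ∣))
        ≡⟨ cong₂ _+_ (sum-replicate-* ∣ G ∣ ∣ G ∣) (sum-𝟙≟-* 0ᶠ (λ _ → ∣ H ∣ * ∣ G ∣)) ⟩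
      ∣ G ∣ * ∣ G ∣ + ∣ H ∣ * ∣ G ∣ ∎
      where open ≡-Reasoning

-- Surjectivity and singleton preimages

fibre-nonempty : ∀ .{{_ : NonZero n}} (v : Vector ℕ m) i → sum v ≡ n → SecondMoment n v →
                     m ^ 2 ≤ n → v i ≢ 0
fibre-nonempty {m = suc m} v i Σv≡n moment m²≤n vi≡0 =
  -- With `suc m` fibres, an empty one would force `suc m ^ 2 ≤ n ≤ m * m < suc m ^ 2`.
  <-irrefl refl (≤-<-trans
    (≤-trans m²≤n (empty-fibre-bound v i Σv≡n moment vi≡0))
    (<-≤-trans (*-mono-< (n<1+n m) (n<1+n m)) (≤-reflexive (sym (cong (suc m *_) (*-identityʳ (suc m)))))))

singleton-fibre-bound-^ : (v : Vector ℕ m) → ∀ i → sum v ≡ n → SecondMoment n v → v i ≡ 1 → n ≤ m ^ 2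
singleton-fibre-bound-^ {m = suc m} v i Σv≡n moment vi≡1 =
  ≤-trans (singleton-fibre-bound v i Σv≡n moment vi≡1)
    (≤-reflexive (sym (cong (suc m *_) (*-identityʳ (suc m)))))

corollary2p7 : ∀ {c₁ ℓ₁ c₂ ℓ₂} (G : FiniteGroup c₁ ℓ₁) (H : FiniteGroup c₂ ℓ₂) (F : Map G H) →
    PerfectNonlinear G H F →
    ∣ H ∣ ^ 2 ≤ ∣ G ∣ →
    Surjective G H F × ((∃[ β ] ∣preimage∣ G H F β ≡ 1) → ∣ H ∣ ^ 2 ≡ ∣ G ∣)
corollary2p7 G H F pn m²≤n = surjective , singleton
  where
  module G = FiniteGroup G
  module H = FiniteGroup H
  module F = Func F
  module eG = Inverse G.enumeration
  module eH = Inverse H.enumeration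
  g = onIndices G H F

  surjective : Surjective G H F
  surjective β
    with i , gi≡β ← fibre≢0⇒∃ g (eH.to β)
           (fibre-nonempty (fibre g) (eH.to β) (sum-fibre g) (secondMoment G H F pn) m²≤n)
    -- Surjectivity between setoids asks for the value at every `z` equivalent to the witness.
    = eG.from i , λ z≈x → H.trans (F.cong z≈x)
        (H.trans (H.sym (eH.strictlyInverseʳ _)) (eH.inverseʳ gi≡β))

  singleton : (∃[ β ] ∣preimage∣ G H F β ≡ 1) → ∣ H ∣ ^ 2 ≡ ∣ G ∣
  singleton (β , ∣β∣≡1) = ≤-antisym m²≤n
    (singleton-fibre-bound-^ (fibre g) (eH.to β) (sum-fibre g) (secondMoment G H F pn)
      (trans (sym (∣preimage∣≡fibre G H F β)) ∣β∣≡1))
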